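{- For every pair $\pi,\tau\in\mathcal{U}_n$, $\pi\le\tau$ in the weak order $\mathrm{Weak}(\mathcal{S}_n)$ if and only if (i) either $\pi,\tau\in\mathcal{L}_n$ or $\pi,\tau\in w_0\mathcal{L}_nw_0$, and (ii) $\mathrm{shape}(\pi)\subseteq\mathrm{shape}(\tau)$.
   Context: A permutation $\pi\in\mathcal{S}_n$ is left-unimodal if every prefix set $\{\pi(1),\dots,\pi(j)\}$, $1\le j\le n$, is an interval $\{a,a+1,\dots,b\}$ in $\mathbb{Z}$; it is unimodal if either it is left-unimodal or every suffix set $\{\pi(j),\dots,\pi(n)\}$, $1\le j\le n$, is an interval in $\mathbb{Z}$. $\mathcal{L}_n\subseteq\mathcal{U}_n$ denote the sets of left-unimodal and of unimodal permutations in $\mathcal{S}_n$. $w_0=n\cdots21$ is the longest permutation, and $w_0\mathcal{L}_nw_0=\{w_0\pi w_0:\pi\in\mathcal{L}_n\}$. Weak order: $\ell$ is the length function (number of inversions) of $\mathcal{S}_n$ with respect to the adjacent transpositions $\sigma_i=(i,i+1)$, $1\le i\le n-1$; $\mathrm{Weak}(\mathcal{S}_n)$ is the (right) weak order: $\pi\le\tau$ iff $\ell(\pi)+\ell(\pi^{ -1}\tau)=\ell(\tau)$, where $\pi\tau$ denotes the composition $(\pi\tau)(x)=\pi(\tau(x))$ (so $\pi\sigma_i$ is $\pi$ with the letters in positions $i,i+1$ exchanged). Shape: the shifted staircase $\Delta_n$ is the set of boxes $(i,j)$, $1\le i<j\le n$ ($i$ the row, from top to bottom; $j$ the column, from left to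 right). A partial filling of $\Delta_n$ is obtained from a filling of $\Delta_n$ with $1,\dots,n(n-1)/2$, each used once, increasing along rows and columns, by erasing the numbers greater than $k$ for some $k$. If entry $r$ lies in box $(i,j)$, let $t_r$ be the transposition $(i,j)$; the permutation associated with the partial filling is the one sending $x$ to the result of applying $t_1$, then $t_2$, ..., then $t_k$ to $x$. The permutations so obtained are exactly those of $\mathcal{L}_n$, and all partial fillings giving the same $\pi\in\mathcal{L}_n$ have the same set of filled boxes; this set is $\mathrm{shape}(\pi)$. For $\pi\in\mathcal{U}_n\setminus\mathcal{L}_n$ one has $w_0\pi w_0\in\mathcal{L}_n$ and $\mathrm{shape}(\pi):=\mathrm{shape}(w_0\pi w_0)$. -}

module Defs where

open import Data.Bool.Base using (if_then_else_)
open import Data.Fin.Base using (Fin; toℕ; _<_; _≤_)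
open import Data.Fin.Permutation
  using (Permutation′; _⟨$⟩ʳ_; _≈_; _∘ₚ_; flip; id; transpose; reverse)
open import Data.Fin.Properties using (_<?_)
open import Data.List.Base using (List; foldr; tabulate; take)
open import Data.Nat.Base as ℕ using (ℕ; _+_; _*_; _∸_; _/_)
open import Data.Nat.Properties using (+-0-commutativeMonoid)
open import Data.Product.Base using (_×_; ∃; ∃₂)
open import Data.Sum.Base using (_⊎_)
open import Function.Bundles using (_⇔_; _↔_; Inverse)
open import Level using (0ℓ)
open import Relation.Binary.PropositionalEquality.Core using (_≡_)
open import Relation.Nullary.Decidable.Core using (does; _×-dec_)
open import Relation.Unary using (Pred; _∈_; _∉_)

open import Algebra.Properties.CommutativeMonoid.Sum +-0-commutativeMonoid
  using (sum-syntax)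

-- The letters 1, …, n and the positions 1, …, n are both represented by
-- Fin n, i.e. shifted down by one throughout.  Permutations are compared by
-- the pointwise equality _≈_, and  π ∘ₚ ρ  applies π first, then ρ.

private
  variable
    n : ℕ

------------------------------------------------------------------------
-- Unimodal permutations

IsInterval : Pred (Pred (Fin n) 0ℓ) 0ℓ
IsInterval {n} P = ∃₂ λ (a b : Fin n) → ∀ y → y ∈ P ⇔ (a ≤ y × y ≤ b)

-- The index j is the last position of the prefix (first of the suffix).

prefixSet : Permutation′ n → Fin n → Pred (Fin n) 0ℓ
prefixSet π j y = ∃ λ i → i ≤ j × π ⟨$⟩ʳ i ≡ y

suffixSet : Permutation′ n → Fin n → Pred (Fin n) 0ℓ
suffixSet π j y = ∃ λ i → j ≤ i × π ⟨$⟩ʳ i ≡ y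

LeftUnimodal : Pred (Permutation′ n) 0ℓ
LeftUnimodal π = ∀ j → IsInterval (prefixSet π j)

Unimodal : Pred (Permutation′ n) 0ℓ
Unimodal π = LeftUnimodal π ⊎ (∀ j → IsInterval (suffixSet π j))

w₀ : Permutation′ n
w₀ = reverse

w₀-conj : Permutation′ n → Permutation′ n
w₀-conj π = w₀ ∘ₚ π ∘ₚ w₀

w₀LeftUnimodalw₀ : Pred (Permutation′ n) 0ℓ
w₀LeftUnimodalw₀ σ = ∃ λ π → LeftUnimodal π × σ ≈ w₀-conj π

------------------------------------------------------------------------
-- Right weak order

ℓ : Permutation′ n → ℕ
ℓ {n} π = ∑[ i < n ] ∑[ j < n ]
  (if does ((i <? j) ×-dec ((π ⟨$⟩ʳ j) <? (π ⟨$⟩ʳ i))) then 1 else 0)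

-- Since _∘ₚ_ is diagrammatic,  τ ∘ₚ flip π  is the map x ↦ π⁻¹ (τ x).

infix 4 _≤ᵂ_

_≤ᵂ_ : Permutation′ n → Permutation′ n → Set
π ≤ᵂ τ = ℓ π + ℓ (τ ∘ₚ flip π) ≡ ℓ τ

------------------------------------------------------------------------
-- Partial fillings of the shifted staircase

record Box (n : ℕ) : Set where
  constructor box
  field
    row col  : Fin n
    .row<col : row < col

open Box public using (row; col)

-- The number in a box is one more than its entry.

record Filling (n : ℕ) : Set where
  field
    entries : Box n ↔ Fin (n * (n ∸ 1) / 2)

  entry : Box n → Fin (n * (n ∸ 1) / 2)
  entry = Inverse.to entries

  boxOf : Fin (n * (n ∸ 1) / 2) → Box n
  boxOf = Inverse.from entries

  field
    row-increasing : ∀ b c → row b ≡ row c → col b < col c → entry b < entry c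
    col-increasing : ∀ b c → col b ≡ col c → row b < row c → entry b < entry c

-- The filling with the numbers greater than `size` erased.

record PartialFilling (n : ℕ) : Set where
  field
    filling : Filling n
    size    : ℕ

  open Filling filling public

  Filled : Pred (Box n) 0ℓ
  Filled b = toℕ (entry b) ℕ.< size

  boxSequence : List (Box n)
  boxSequence = take size (tabulate boxOf)

  toPermutation : Permutation′ n
  toPermutation = foldr (λ b ρ → transpose (row b) (col b) ∘ₚ ρ) id boxSequence

open PartialFilling public using (Filled; toPermutation)

------------------------------------------------------------------------
-- Shapes

-- All partial fillings with the same permutation fill the same boxes, so
-- this union over all of them is that common set of filled boxes.

shapeᴸ : Permutation′ n → Pred (Box n) 0ℓ
shapeᴸ {n} π b = ∃ λ (f : PartialFilling n) → toPermutation f ≈ π × b ∈ Filled f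

-- Only meaningful for unimodal permutations.

shape : Permutation′ n → Pred (Box n) 0ℓ
shape π b = (π ∈ LeftUnimodal × b ∈ shapeᴸ π)
          ⊎ (π ∉ LeftUnimodal × b ∈ shapeᴸ (w₀-conj π))

{-# OPTIONS --safe #-}
-- Let Inv π be the set of boxes (i , j) such that j stands before i in π.  The
-- defect  ℓ(π) + ℓ(π⁻¹τ) - ℓ(τ)  is twice the number of elements of
-- Inv π ∖ Inv τ, so π ≤ τ iff Inv π ⊆ Inv τ.  Building a filling entry by entry,
-- each new box (i , j) is an outer corner of the ideal of filled boxes, which
-- forces the letters i and j to be adjacent; exchanging them adds just (i , j)
-- to the inversions.  Hence the filled boxes are the inversions of the
-- associated permutation.  For left-unimodal π, Inv π is an order ideal of the
-- staircase, and any ideal is an initial segment of some filling, so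
-- shape π = Inv π.  Conjugation by w₀ reflects inversion sets in the
-- antidiagonal; a nonempty ideal contains (1 , 2) and a proper one misses
-- (n-1 , n), so a comparison between the two families involves id or w₀, which
-- belong to both.
module Submission where

open import Defs
open import Data.Bool.Base using (true; false; not; if_then_else_)
open import Data.Fin.Base using (Fin; zero; suc; toℕ; opposite; fromℕ; fromℕ<; _<_; _≤_)
open import Data.Fin.Induction using (<-wellFounded)
open import Data.Fin.Permutation
  using (Permutation′; _⟨$⟩ʳ_; _⟨$⟩ˡ_; _≈_; _∘ₚ_; flip; id; transpose; inverseˡ; inverseʳ; cast-id)
open import Data.Fin.Properties
open import Data.List.Base using (List; []; _∷_; _++_; _∷ʳ_; foldr; map; filter;
  length; lookup; tabulate; take)
open import Data.List.Membership.Propositional using () renaming (_∈_ to _∈ₗ_)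
open import Data.List.Membership.Propositional.Properties
  using (∈-++⁺ˡ; ∈-++⁺ʳ; ∈-filter⁺; ∈-filter⁻; ∈-lookup; ∈-map⁺; ∈-tabulate⁺)
open import Data.List.Properties using (length-++; length-map; length-tabulate;
  take-all; take-suc-tabulate)
open import Data.List.Relation.Unary.All as All using ()
import Data.List.Relation.Unary.All.Properties as All
open import Data.List.Relation.Unary.AllPairs as AllPairs using (AllPairs; []; _∷_)
import Data.List.Relation.Unary.AllPairs.Properties as AllPairs
open import Data.List.Relation.Unary.Any using (here; there; index)
open import Data.List.Relation.Unary.Any.Properties using (lookup-index)
open import Data.Nat.Base as ℕ using (ℕ; z≤n; z<s; s≤s; s<s; _+_; _*_; _∸_; _/_)
open import Data.Nat.DivMod using (m*n/n≡m; +-distrib-/-∣ˡ)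
open import Data.Nat.Divisibility using (n∣m*n)
import Data.Nat.Properties as ℕ
open import Data.Product.Base using (_×_; _,_; proj₁; proj₂; ∃)
open import Data.Product.Function.NonDependent.Propositional using (_×-⇔_)
open import Data.Sum.Base using (_⊎_; inj₁; inj₂; [_,_]′)
open import Data.Sum.Function.Propositional using (_⊎-⇔_)
open import Function.Base using (_∘_; case_of_)
open import Function.Bundles using (_⇔_; _↔_; mk⇔; mk↔ₛ′; Equivalence; Inverse)
open import Function.Construct.Composition using (_↔-∘_)
import Function.Properties.Equivalence as ⇔
open import Induction.WellFounded using (Acc; acc)
open import Relation.Binary.Definitions using (tri<; tri≈; tri>)
open import Relation.Binary.PropositionalEquality
  using (_≡_; _≢_; refl; sym; trans; cong; cong₂; subst; subst₂; module ≡-Reasoning)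
open import Relation.Nullary.Decidable
  using (Dec; yes; no; does; _×-dec_; _→-dec_; map′; dec-true; dec-false; recompute)
open import Relation.Nullary.Negation using (¬_; contradiction)
open import Relation.Unary using (Pred; Decidable; _∈_; _⊆_)
open import Relation.Unary.Properties using (∁?)

open import Algebra.Properties.CommutativeMonoid.Sum ℕ.+-0-commutativeMonoid
  using (sum; sum-syntax; sum-cong-≗; ∑-distrib-+; sum-permute; sum-replicate-zero)

open Equivalence using (to; from)

-- Inversions as boxes of the staircase

private
  variable
    n : ℕ

-- Inversions are recorded by letters, not positions: containment of these sets is the right weak
-- order, and a pair of letters is a box.
Inversion : Permutation′ n → Box n → Set
Inversion π b = π ⟨$⟩ˡ col b < π ⟨$⟩ˡ row b

infix 4 _⊑_

_⊑_ : Permutation′ n → Permutation′ n → Set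
π ⊑ τ = ∀ b → Inversion π b → Inversion τ b

inversion? : (π : Permutation′ n) → Decidable (Inversion π)
inversion? π b = π ⟨$⟩ˡ col b <? π ⟨$⟩ˡ row b

-- The bound stored in a `Box` is irrelevant, so it is recovered by deciding it anew.
row<col : (b : Box n) → row b < col b
row<col (box r c r<c) = recompute (r <? c) r<c

⟨$⟩ʳ-injective : (π : Permutation′ n) {i j : Fin n} → π ⟨$⟩ʳ i ≡ π ⟨$⟩ʳ j → i ≡ j
⟨$⟩ʳ-injective π eq = trans (sym (inverseˡ π)) (trans (cong (π ⟨$⟩ˡ_) eq) (inverseˡ π))

⟨$⟩ˡ-injective : (π : Permutation′ n) {x y : Fin n} → π ⟨$⟩ˡ x ≡ π ⟨$⟩ˡ y → x ≡ y
⟨$⟩ˡ-injective π = ⟨$⟩ʳ-injective (flip π)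

≮∧≢⇒> : {i j : Fin n} → ¬ i < j → i ≢ j → j < i
≮∧≢⇒> {i = i} {j} i≮j i≢j = ≤∧≢⇒< (ℕ.≮⇒≥ i≮j) (i≢j ∘ sym)

-- Weak order and inversions

χ : ∀ {p} {P : Set p} → Dec P → ℕ
χ P? = if does P? then 1 else 0

χ-true : ∀ {p} {P : Set p} (P? : Dec P) → P → χ P? ≡ 1
χ-true P? p = cong (if_then 1 else 0) (dec-true P? p)

χ-false : ∀ {p} {P : Set p} (P? : Dec P) → ¬ P → χ P? ≡ 0
χ-false P? ¬p = cong (if_then 1 else 0) (dec-false P? ¬p)

sum≡0⇒ : (t : Fin n → ℕ) → sum t ≡ 0 → ∀ i → t i ≡ 0
sum≡0⇒ t eq zero    = ℕ.m+n≡0⇒m≡0 _ eq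
sum≡0⇒ t eq (suc i) = sum≡0⇒ (t ∘ suc) (ℕ.m+n≡0⇒n≡0 (t zero) eq) i

sum≡0⇐ : (t : Fin n → ℕ) → (∀ i → t i ≡ 0) → sum t ≡ 0
sum≡0⇐ {n} t eq = trans (sum-cong-≗ eq) (sum-replicate-zero n)

∑∑-distrib-+ : (f g : Fin n → Fin n → ℕ) →
  ∑[ i < n ] ∑[ j < n ] (f i j + g i j) ≡ ∑[ i < n ] ∑[ j < n ] f i j + ∑[ i < n ] ∑[ j < n ] g i j
∑∑-distrib-+ f g =
  trans (sum-cong-≗ λ i → ∑-distrib-+ (f i) (g i)) (∑-distrib-+ (sum ∘ f) (sum ∘ g))

-- Lets one Boolean govern both orders of a pair, which reduces `pointwise` to a truth table.
does->? : {i j : Fin n} → i ≢ j → does (j <? i) ≡ not (does (i <? j))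
does->? {i = i} {j} i≢j with <-cmp i j
... | tri< i<j _ j≮i rewrite dec-true (i <? j) i<j | dec-false (j <? i) j≮i = refl
... | tri≈ _ i≡j _ = contradiction i≡j i≢j
... | tri> i≮j _ j<i rewrite dec-false (i <? j) i≮j | dec-true (j <? i) j<i = refl

module WeakOrder {n} (π τ : Permutation′ n) where

  ρ : Permutation′ n
  ρ = τ ∘ₚ flip π

  -- The pairs of letters that π inverts and τ does not, indexed by their
  -- positions in τ.
  defect : Fin n → Fin n → ℕ
  defect i j = χ ((j <? i) ×-dec (ρ ⟨$⟩ʳ i <? ρ ⟨$⟩ʳ j) ×-dec (τ ⟨$⟩ʳ j <? τ ⟨$⟩ʳ i))

  -- `ρ` carries a position in `τ` to the position of the same letter in `π`, so `inv-π` reads the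
  -- inversions of `π` off positions in `τ`.
  inv-π inv-ρ inv-τ : Fin n → Fin n → ℕ
  inv-π i j = χ ((ρ ⟨$⟩ʳ i <? ρ ⟨$⟩ʳ j) ×-dec (τ ⟨$⟩ʳ j <? τ ⟨$⟩ʳ i))
  inv-ρ i j = χ ((i <? j) ×-dec (ρ ⟨$⟩ʳ j <? ρ ⟨$⟩ʳ i))
  inv-τ i j = χ ((i <? j) ×-dec (τ ⟨$⟩ʳ j <? τ ⟨$⟩ʳ i))

  -- For `j < i` only `inv-π i j` and `defect i j` survive, and they coincide. For `i < j` an
  -- inversion of `ρ` marks two letters that `π` and `τ` order differently; if `τ` does not invert
  -- them then `π` does, and `defect j i` accounts for it.
  pointwise : ∀ i j → inv-π i j + inv-ρ i j ≡ inv-τ i j + (defect i j + defect j i)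
  pointwise i j with i ≟ j
  ... | yes refl rewrite dec-false (i <? i) (<-irrefl refl)
                       | dec-false (ρ ⟨$⟩ʳ i <? ρ ⟨$⟩ʳ i) (<-irrefl refl) = refl
  ... | no i≢j rewrite does->? i≢j
                     | does->? (i≢j ∘ ⟨$⟩ʳ-injective ρ)
                     | does->? (i≢j ∘ ⟨$⟩ʳ-injective τ)
      with does (i <? j) | does (ρ ⟨$⟩ʳ i <? ρ ⟨$⟩ʳ j) | does (τ ⟨$⟩ʳ i <? τ ⟨$⟩ʳ j)
  ... | true  | true  | true  = refl
  ... | true  | true  | false = refl
  ... | true  | false | true  = refl
  ... | true  | false | false = refl
  ... | false | true  | true  = refl
  ... | false | true  | false = refl
  ... | false | false | true  = refl
  ... | false | false | false = refl

  ℓ-reindexed : ℓ π ≡ ∑[ i < n ] ∑[ j < n ] inv-π i j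
  ℓ-reindexed = trans
    (sum-permute (λ x → ∑[ y < n ] inv x y) ρ)
    (sum-cong-≗ λ i → trans (sum-permute (inv (ρ ⟨$⟩ʳ i)) ρ)
      (sum-cong-≗ λ j → cong₂ (λ u v → χ ((ρ ⟨$⟩ʳ i <? ρ ⟨$⟩ʳ j) ×-dec (u <? v)))
        (inverseʳ π) (inverseʳ π)))
    where
    inv : Fin n → Fin n → ℕ
    inv x y = χ ((x <? y) ×-dec (π ⟨$⟩ʳ y <? π ⟨$⟩ʳ x))

  totalDefect : ℕ
  totalDefect = ∑[ i < n ] ∑[ j < n ] (defect i j + defect j i)

  ℓ-defect : ℓ π + ℓ ρ ≡ ℓ τ + totalDefect
  ℓ-defect = begin
    ℓ π + ℓ ρ                                             ≡⟨ cong (_+ ℓ ρ) ℓ-reindexed ⟩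
    ∑[ i < n ] ∑[ j < n ] inv-π i j + ℓ ρ                 ≡⟨ ∑∑-distrib-+ inv-π inv-ρ ⟨
    ∑[ i < n ] ∑[ j < n ] (inv-π i j + inv-ρ i j)         ≡⟨ sum-cong-≗ (λ i → sum-cong-≗ (pointwise i)) ⟩
    ∑[ i < n ] ∑[ j < n ] (inv-τ i j + (defect i j + defect j i))
      ≡⟨ ∑∑-distrib-+ inv-τ (λ i j → defect i j + defect j i) ⟩
    ℓ τ + totalDefect                                     ∎
    where open ≡-Reasoning

  -- Cancelling `ℓ τ` in `ℓ-defect` makes every term of the total defect vanish, but a box inverted
  -- by `π` and not by `τ` would contribute 1.
  ≤ᵂ⇒⊑ : π ≤ᵂ τ → π ⊑ τ
  ≤ᵂ⇒⊑ π≤τ b πb with inversion? τ b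
  ... | yes τb = τb
  ... | no ¬τb = contradiction (trans (sym is-one) is-zero) λ ()
    where
    i j : Fin n
    i = τ ⟨$⟩ˡ col b
    j = τ ⟨$⟩ˡ row b
    is-zero : defect i j ≡ 0
    is-zero = ℕ.m+n≡0⇒m≡0 _ (sum≡0⇒ _ (sum≡0⇒ _ (ℕ.+-cancelˡ-≡ (ℓ τ) _ _
      (trans (sym ℓ-defect) (trans π≤τ (sym (ℕ.+-identityʳ _))))) i) j)
    is-one : defect i j ≡ 1
    is-one = χ-true ((j <? i) ×-dec (ρ ⟨$⟩ʳ i <? ρ ⟨$⟩ʳ j) ×-dec (τ ⟨$⟩ʳ j <? τ ⟨$⟩ʳ i))
      ( ≮∧≢⇒> ¬τb (<⇒≢ (row<col b) ∘ sym ∘ ⟨$⟩ˡ-injective τ)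
      , subst₂ _<_ (cong (π ⟨$⟩ˡ_) (sym (inverseʳ τ))) (cong (π ⟨$⟩ˡ_) (sym (inverseʳ τ))) πb
      , subst₂ _<_ (sym (inverseʳ τ)) (sym (inverseʳ τ)) (row<col b))

  ⊑⇒≤ᵂ : π ⊑ τ → π ≤ᵂ τ
  ⊑⇒≤ᵂ π⊑τ = trans ℓ-defect (trans (cong (ℓ τ +_) total≡0) (ℕ.+-identityʳ _))
    where
    defect≡0 : ∀ i j → defect i j ≡ 0
    defect≡0 i j = χ-false ((j <? i) ×-dec (ρ ⟨$⟩ʳ i <? ρ ⟨$⟩ʳ j) ×-dec (τ ⟨$⟩ʳ j <? τ ⟨$⟩ʳ i))
      λ (j<i , ρi<ρj , τj<τi) → <-asym j<i
        (subst₂ _<_ (inverseˡ τ) (inverseˡ τ) (π⊑τ (box _ _ τj<τi) ρi<ρj))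
    total≡0 : totalDefect ≡ 0
    total≡0 = sum≡0⇐ _ λ i → sum≡0⇐ _ λ j → cong₂ _+_ (defect≡0 i j) (defect≡0 j i)

-- Permutations are determined by their inversions

StrictlyMonotone : (Fin n → Fin n) → Set
StrictlyMonotone f = ∀ {i j} → i < j → f i < f j

-- A point with `f i < i` would start an infinite descent through `f i`, `f (f i)` and so on.
monotone⇒≮ : (f : Fin n → Fin n) → StrictlyMonotone f → ∀ i → ¬ f i < i
monotone⇒≮ f mono i = go i (<-wellFounded i)
  where
  go : ∀ i → Acc _<_ i → ¬ f i < i
  go i (acc rs) fi<i = go (f i) (rs fi<i) (mono fi<i)

sameInversions⇒monotone : (π τ : Permutation′ n) → (∀ b → Inversion π b ⇔ Inversion τ b) →
  StrictlyMonotone (λ i → τ ⟨$⟩ˡ (π ⟨$⟩ʳ i))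
sameInversions⇒monotone π τ same {i} {j} i<j with <-cmp (π ⟨$⟩ʳ i) (π ⟨$⟩ʳ j)
... | tri< a<b a≢b _ = ≮∧≢⇒>
  (λ b-a → <-asym i<j (subst₂ _<_ (inverseˡ π) (inverseˡ π) (from (same (box _ _ a<b)) b-a)))
  (a≢b ∘ sym ∘ ⟨$⟩ˡ-injective τ)
... | tri≈ _ a≡b _ = contradiction (⟨$⟩ʳ-injective π a≡b) (<⇒≢ i<j)
... | tri> _ _ b<a = to (same (box _ _ b<a)) (subst₂ _<_ (sym (inverseˡ π)) (sym (inverseˡ π)) i<j)

-- The map `τ⁻¹π` and its inverse are both strictly monotone, so neither moves a point down; if one
-- moved a point up, the other would move the image down.
sameInversions⇒≈ : (π τ : Permutation′ n) → (∀ b → Inversion π b ⇔ Inversion τ b) → π ≈ τ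
sameInversions⇒≈ π τ same i with <-cmp (τ ⟨$⟩ˡ (π ⟨$⟩ʳ i)) i
... | tri< lt _ _ = contradiction lt (monotone⇒≮ _ (sameInversions⇒monotone π τ same) i)
... | tri≈ _ eq _ = trans (sym (inverseʳ τ)) (cong (τ ⟨$⟩ʳ_) eq)
... | tri> _ _ gt = contradiction
  (subst (_< (τ ⟨$⟩ˡ (π ⟨$⟩ʳ i))) (sym (trans (cong (π ⟨$⟩ˡ_) (inverseʳ τ)) (inverseˡ π))) gt)
  (monotone⇒≮ (λ j → π ⟨$⟩ˡ (τ ⟨$⟩ʳ j)) (sameInversions⇒monotone τ π (⇔.sym ∘ same)) _)

≈⇒⟨$⟩ˡ : (π τ : Permutation′ n) → π ≈ τ → ∀ x → π ⟨$⟩ˡ x ≡ τ ⟨$⟩ˡ x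
≈⇒⟨$⟩ˡ π τ π≈τ x = ⟨$⟩ʳ-injective τ
  (trans (sym (π≈τ _)) (trans (inverseʳ π) (sym (inverseʳ τ))))

-- Order ideals of the staircase

infix 4 _⊏_

-- Only the comparisons that a `Filling` must respect; `ideal-below` recovers the componentwise
-- order.
_⊏_ : Box n → Box n → Set
b ⊏ c = (row b ≡ row c × col b < col c) ⊎ (col b ≡ col c × row b < row c)

IsIdeal : Pred (Box n) _ → Set
IsIdeal S = ∀ b c → b ⊏ c → S c → S b

LeftUnimodal⇒convex : (π : Permutation′ n) → LeftUnimodal π → ∀ {a c b j} → a ≤ c → c ≤ b →
  π ⟨$⟩ˡ a ≤ j → π ⟨$⟩ˡ b ≤ j → π ⟨$⟩ˡ c ≤ j
LeftUnimodal⇒convex π lu {a} {c} {b} {j} a≤c c≤b pa≤j pb≤j =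
  let l , u , interval = lu j
      l≤a , _ = to (interval a) (π ⟨$⟩ˡ a , pa≤j , inverseʳ π)
      _ , b≤u = to (interval b) (π ⟨$⟩ˡ b , pb≤j , inverseʳ π)
      i , i≤j , πi≡c = from (interval c) (≤-trans l≤a a≤c , ≤-trans c≤b b≤u)
  in subst (_≤ j) (trans (sym (inverseˡ π)) (cong (π ⟨$⟩ˡ_) πi≡c)) i≤j

-- In a row, `col b` lies between `row c` and `col c`, neither of which stands after `row c`. In a
-- column, `row c` lies between `row b` and `col c`; were `row b` not after `col c`, neither would
-- `row c` be.
LeftUnimodal⇒ideal : (π : Permutation′ n) → LeftUnimodal π → IsIdeal (Inversion π)
LeftUnimodal⇒ideal π lu b c (inj₁ (refl , cb<cc)) πc = ≤∧≢⇒<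
  (LeftUnimodal⇒convex π lu (ℕ.<⇒≤ (row<col b)) (ℕ.<⇒≤ cb<cc) ≤-refl (ℕ.<⇒≤ πc))
  (<⇒≢ (row<col b) ∘ sym ∘ ⟨$⟩ˡ-injective π)
LeftUnimodal⇒ideal π lu b c (inj₂ (refl , rb<rc)) πc = ℕ.≰⇒> λ rb≤cb →
  ℕ.<⇒≱ πc (LeftUnimodal⇒convex π lu (ℕ.<⇒≤ rb<rc) (ℕ.<⇒≤ (row<col c)) rb≤cb ≤-refl)

ideal-below : (S : Pred (Box n) _) → IsIdeal S → ∀ {b c} → row b ≤ row c → col b ≤ col c → S c → S b
ideal-below S ideal {b} {c} rb≤rc cb≤cc Sc = along-row (col b ≟ col c)
  where
  -- Of the two corners joining `b` to `c` this one always lies in the staircase, whereas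
  -- `(row c , col b)` may not.
  d : Box _
  d = box (row b) (col c) (ℕ.<-≤-trans (row<col b) cb≤cc)
  along-col : Dec (row b ≡ row c) → S d
  along-col (yes refl) = Sc
  along-col (no rb≢rc) = ideal d c (inj₂ (refl , ≤∧≢⇒< rb≤rc rb≢rc)) Sc
  along-row : Dec (col b ≡ col c) → S b
  along-row (yes refl) = along-col (row b ≟ row c)
  along-row (no cb≢cc) = ideal b d (inj₁ (refl , ≤∧≢⇒< cb≤cc cb≢cc)) (along-col (row b ≟ row c))

-- The permutation of a partial filling

applyBoxes : List (Box n) → Permutation′ n
applyBoxes = foldr (λ b ρ → transpose (row b) (col b) ∘ₚ ρ) id

-- The new transposition is applied last, exchanging two letters; hence it comes first in the
-- inverse, which is what `Inversion` reads.
applyBoxes-∷ʳ : (bs : List (Box n)) (b : Box n) (x : Fin n) →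
  applyBoxes (bs ∷ʳ b) ⟨$⟩ˡ x ≡ applyBoxes bs ⟨$⟩ˡ (transpose (row b) (col b) ⟨$⟩ˡ x)
applyBoxes-∷ʳ []       b x = refl
applyBoxes-∷ʳ (c ∷ bs) b x = cong (transpose (row c) (col c) ⟨$⟩ˡ_) (applyBoxes-∷ʳ bs b x)

transpose-row : (i j : Fin n) → transpose i j ⟨$⟩ˡ i ≡ j
transpose-row i j with i ≟ j
... | yes refl = refl
... | no i≢j rewrite dec-true (i ≟ i) refl = refl

transpose-col : (i j : Fin n) → transpose i j ⟨$⟩ˡ j ≡ i
transpose-col i j rewrite dec-true (j ≟ j) refl = refl

transpose-other : (i j : Fin n) {x : Fin n} → x ≢ i → x ≢ j → transpose i j ⟨$⟩ˡ x ≡ x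
transpose-other i j {x} x≢i x≢j rewrite dec-false (x ≟ j) x≢j | dec-false (x ≟ i) x≢i = refl

box-≡ : {b c : Box n} → row b ≡ row c → col b ≡ col c → b ≡ c
box-≡ refl refl = refl

-- σ is the transposition of row b and col b, known only through its values since
-- the with-clauses of transpose would block rewriting.
module AdjacentSwap (π : Permutation′ n) (b : Box n) (σ : Fin n → Fin n)
         (σ-row : σ (row b) ≡ col b) (σ-col : σ (col b) ≡ row b)
         (σ-other : ∀ {x} → x ≢ row b → x ≢ col b → σ x ≡ x)
         (row-first : π ⟨$⟩ˡ row b < π ⟨$⟩ˡ col b)
         (adjacent : ∀ c → π ⟨$⟩ˡ row b < π ⟨$⟩ˡ c → ¬ π ⟨$⟩ˡ c < π ⟨$⟩ˡ col b) where

  private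
    i j : Fin n
    i = row b
    j = col b

    -- As no letter stands between `i` and `j`, a third letter is on the same side of both.
    above : ∀ {c} → c ≢ j → π ⟨$⟩ˡ i < π ⟨$⟩ˡ c → π ⟨$⟩ˡ j < π ⟨$⟩ˡ c
    above c≢j i<c = ≮∧≢⇒> (adjacent _ i<c) (c≢j ∘ ⟨$⟩ˡ-injective π)

    below : ∀ {c} → c ≢ i → π ⟨$⟩ˡ c < π ⟨$⟩ˡ j → π ⟨$⟩ˡ c < π ⟨$⟩ˡ i
    below c≢i c<j = ≮∧≢⇒> (λ i<c → adjacent _ i<c c<j) (c≢i ∘ sym ∘ ⟨$⟩ˡ-injective π)

  -- Pairs avoiding `i` and `j` are untouched, pairs with one of them keep their order by `above`
  -- and `below`, and only the pair itself is reversed.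
  inversions-swap : ∀ c → (π ⟨$⟩ˡ σ (col c) < π ⟨$⟩ˡ σ (row c)) ⇔ (Inversion π c ⊎ c ≡ b)
  inversions-swap c@(box x y _) with x ≟ i | y ≟ j
  ... | yes refl | yes refl rewrite σ-row | σ-col =
    mk⇔ (λ _ → inj₂ refl) (λ _ → row-first)
  ... | yes refl | no y≢j
    rewrite σ-row | σ-other (<⇒≢ (row<col c) ∘ sym) y≢j =
    mk⇔ (inj₁ ∘ below (<⇒≢ (row<col c) ∘ sym))
        [ (λ y<i → <-trans y<i row-first) , (λ { refl → contradiction refl y≢j }) ]′
  ... | no x≢i | yes refl
    rewrite σ-col | σ-other x≢i (<⇒≢ (row<col c)) =
    mk⇔ (inj₁ ∘ above (<⇒≢ (row<col c)))
        [ <-trans row-first , (λ { refl → contradiction refl x≢i }) ]′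
  ... | no x≢i | no y≢j with x ≟ j | y ≟ i
  ... | yes refl | yes refl = contradiction (row<col c) (<-asym (row<col b))
  ... | yes refl | no y≢i
    rewrite σ-col | σ-other y≢i y≢j =
    mk⇔ (λ y<i → inj₁ (<-trans y<i row-first))
        [ below y≢i , (λ { refl → contradiction refl x≢i }) ]′
  ... | no x≢j | yes refl
    rewrite σ-row | σ-other x≢i x≢j =
    mk⇔ (λ j<x → inj₁ (<-trans row-first j<x))
        [ above x≢j , (λ { refl → contradiction refl y≢j }) ]′
  ... | no x≢j | no y≢i
    rewrite σ-other x≢i x≢j | σ-other y≢i y≢j =
    mk⇔ inj₁ [ (λ y<x → y<x) , (λ { refl → contradiction refl x≢i }) ]′

module _ (F : Filling n) where
  open Filling F

  private
    N : ℕ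
    N = n * (n ∸ 1) / 2

  applyFirst : ℕ → Permutation′ n
  applyFirst k = applyBoxes (take k (tabulate boxOf))

  entry-⊏ : {b c : Box n} → b ⊏ c → entry b < entry c
  entry-⊏ (inj₁ (r≡ , c<)) = row-increasing _ _ r≡ c<
  entry-⊏ (inj₂ (c≡ , r<)) = col-increasing _ _ c≡ r<

  module _ (k : Fin N)
           (inv : ∀ b → Inversion (applyFirst (toℕ k)) b ⇔ entry b < k) where

    private
      π : Permutation′ n
      π = applyFirst (toℕ k)
      β : Box n
      β = boxOf k
      i j : Fin n
      i = row β
      j = col β

      entryβ : entry β ≡ k
      entryβ = Inverse.inverseˡ entries refl

      before-k : {b : Box n} → b ⊏ β → Inversion π b
      before-k {b} b⊏β = from (inv b) (subst (entry b <_) entryβ (entry-⊏ b⊏β))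

      ¬inverted : ¬ Inversion π β
      ¬inverted π-β = <-irrefl entryβ (to (inv β) π-β)

      i-before-j : π ⟨$⟩ˡ i < π ⟨$⟩ˡ j
      i-before-j = ≮∧≢⇒> ¬inverted (<⇒≢ (row<col β) ∘ sym ∘ ⟨$⟩ˡ-injective π)

      -- For `c < i` the filled box `(c , j)` puts `j` before `c`; for `i < c < j` the filled box
      -- `(i , c)` puts `c` before `i`. For `j < c`, if `c` stood before `j` then `(j , c)` would be
      -- filled, hence also `(i , c)` above it, putting `c` before `i`.
      adjacent : ∀ c → π ⟨$⟩ˡ i < π ⟨$⟩ˡ c → ¬ π ⟨$⟩ˡ c < π ⟨$⟩ˡ j
      adjacent c i<c c<j with <-cmp c i | <-cmp c j
      ... | tri< c<i _ _ | _ =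
        <-asym c<j (before-k {box c j (<-trans c<i (row<col β))} (inj₂ (refl , c<i)))
      ... | tri≈ _ refl _ | _ = <-irrefl refl i<c
      ... | tri> _ _ c>i | tri< c<j′ _ _ =
        <-asym i<c (before-k {box i c c>i} (inj₁ (refl , c<j′)))
      ... | tri> _ _ c>i | tri≈ _ refl _ = <-irrefl refl c<j
      ... | tri> _ _ c>i | tri> _ _ j<c = <-asym i<c (from (inv (box i c c>i))
        (<-trans (entry-⊏ {box i c c>i} {box j c j<c} (inj₂ (refl , row<col β)))
                 (to (inv (box j c j<c)) c<j)))

    inversions-suc : ∀ b → Inversion (applyFirst (ℕ.suc (toℕ k))) b ⇔ toℕ (entry b) ℕ.< ℕ.suc (toℕ k)
    inversions-suc b
      rewrite take-suc-tabulate boxOf k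
            | applyBoxes-∷ʳ (take (toℕ k) (tabulate boxOf)) β (col b)
            | applyBoxes-∷ʳ (take (toℕ k) (tabulate boxOf)) β (row b) =
      ⇔.trans (AdjacentSwap.inversions-swap π β (transpose i j ⟨$⟩ˡ_)
        (transpose-row i j) (transpose-col i j) (transpose-other i j) i-before-j adjacent b) (mk⇔
        [ (λ π-b → ℕ.m<n⇒m<1+n (to (inv b) π-b))
        , (λ { refl → ℕ.≤-reflexive (cong (ℕ.suc ∘ toℕ) entryβ) }) ]′
        (λ b≤k → case ℕ.m<1+n⇒m<n∨m≡n b≤k of λ
          { (inj₁ b<k) → inj₁ (from (inv b) b<k)
          ; (inj₂ b≡k) → inj₂ (trans (sym (Inverse.inverseʳ entries refl))
                                     (cong boxOf (toℕ-injective b≡k))) }))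

  inversions-applyFirst : ∀ k b → Inversion (applyFirst k) b ⇔ toℕ (entry b) ℕ.< k
  inversions-applyFirst ℕ.zero b = mk⇔ (λ col<row → contradiction col<row (<-asym (row<col b))) λ ()
  inversions-applyFirst (ℕ.suc k) b with k ℕ.<? N
  ... | yes k<N = subst (λ m → Inversion (applyFirst (ℕ.suc m)) b ⇔ toℕ (entry b) ℕ.< ℕ.suc m)
    (toℕ-fromℕ< k<N)
    (inversions-suc (fromℕ< k<N) (subst (λ m → ∀ b → Inversion (applyFirst m) b ⇔ toℕ (entry b) ℕ.< m)
      (sym (toℕ-fromℕ< k<N)) (inversions-applyFirst k)) b)
  -- The size of a partial filling is unbounded: past the last entry `take` is saturated and every
  -- box is filled.
  ... | no k≮N = mk⇔
    (λ _ → ℕ.m<n⇒m<1+n entry<k)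
    (λ _ → subst (λ bs → Inversion (applyBoxes bs) b)
      (trans (take-all′ k k≥) (sym (take-all′ (ℕ.suc k) (ℕ.m≤n⇒m≤1+n k≥))))
      (from (inversions-applyFirst k b) entry<k))
    where
    entry<k : toℕ (entry b) ℕ.< k
    entry<k = ℕ.<-≤-trans (toℕ<n (entry b)) (ℕ.≮⇒≥ k≮N)
    k≥ : length (tabulate boxOf) ℕ.≤ k
    k≥ = subst (ℕ._≤ k) (sym (length-tabulate boxOf)) (ℕ.≮⇒≥ k≮N)
    take-all′ : ∀ k → length (tabulate boxOf) ℕ.≤ k → take k (tabulate boxOf) ≡ tabulate boxOf
    take-all′ k = take-all k (tabulate boxOf)

filled⇔inversion : (f : PartialFilling n) (b : Box n) → Filled f b ⇔ Inversion (toPermutation f) b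
filled⇔inversion f b = ⇔.sym (inversions-applyFirst (PartialFilling.filling f) (PartialFilling.size f) b)

-- Fillings whose first entries fill a given ideal

infix 4 _<ˡᵉˣ_

-- Row-by-row reading order, a linear extension of `_⊏_`.
_<ˡᵉˣ_ : Box n → Box n → Set
b <ˡᵉˣ c = row b < row c ⊎ (row b ≡ row c × col b < col c)

shift : Box n → Box (ℕ.suc n)
shift (box r c r<c) = box (suc r) (suc c) (s<s r<c)

inFirstRow : Fin n → Box (ℕ.suc n)
inFirstRow j = box zero (suc j) z<s

boxes : ∀ n → List (Box n)
boxes ℕ.zero    = []
boxes (ℕ.suc n) = tabulate inFirstRow ++ map shift (boxes n)

length-boxes : ∀ n → length (boxes n) ≡ n * (n ∸ 1) / 2
length-boxes ℕ.zero            = refl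
length-boxes (ℕ.suc ℕ.zero)    = refl
length-boxes (ℕ.suc n@(ℕ.suc m)) = begin
  length (boxes (ℕ.suc n))        ≡⟨ length-++ (tabulate (inFirstRow {n})) ⟩
  length (tabulate (inFirstRow {n})) + length (map shift (boxes n))
    ≡⟨ cong₂ _+_ (length-tabulate (inFirstRow {n})) (length-map shift (boxes n)) ⟩
  n + length (boxes n)            ≡⟨ cong (n +_) (length-boxes n) ⟩
  -- Rounded division distributes over a sum once one summand is divisible, so `n` becomes
  -- `n * 2 / 2`.
  n + n * m / 2                   ≡⟨ cong (_+ n * m / 2) (m*n/n≡m n 2) ⟨
  n * 2 / 2 + n * m / 2           ≡⟨ +-distrib-/-∣ˡ (n * m) (n∣m*n n) ⟨
  (n * 2 + n * m) / 2             ≡⟨ cong (_/ 2) (ℕ.*-distribˡ-+ n 2 m) ⟨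
  n * ℕ.suc n / 2                 ≡⟨ cong (_/ 2) (ℕ.*-comm n (ℕ.suc n)) ⟩
  ℕ.suc n * n / 2                 ∎
  where open ≡-Reasoning

∈-boxes : (b : Box n) → b ∈ₗ boxes n
∈-boxes (box zero    (suc c) _)   = ∈-++⁺ˡ (∈-tabulate⁺ {f = inFirstRow} c)
∈-boxes (box (suc r) (suc c) r<c) =
  ∈-++⁺ʳ (tabulate inFirstRow) (∈-map⁺ shift (∈-boxes (box r c (ℕ.s<s⁻¹ r<c))))

boxes-sorted : ∀ n → AllPairs _<ˡᵉˣ_ (boxes n)
boxes-sorted ℕ.zero    = []
boxes-sorted (ℕ.suc n) = AllPairs.++⁺
  (AllPairs.tabulate⁺-< {f = inFirstRow} λ i<j → inj₂ (refl {x = zero} , s<s i<j))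
  (AllPairs.map⁺ (AllPairs.map (λ {b} {c} → shift-< {b} {c}) (boxes-sorted n)))
  (All.tabulate⁺ λ _ → All.map⁺ (All.universal (λ _ → inj₁ z<s) (boxes n)))
  where
  shift-< : {b c : Box n} → b <ˡᵉˣ c → shift b <ˡᵉˣ shift c
  shift-< (inj₁ r<)        = inj₁ (s<s r<)
  shift-< (inj₂ (r≡ , c<)) = inj₂ (cong suc r≡ , s<s c<)

⊏-irrefl : {b : Box n} → ¬ b ⊏ b
⊏-irrefl (inj₁ (_ , c<)) = <-irrefl refl c<
⊏-irrefl (inj₂ (_ , r<)) = <-irrefl refl r<

⊏⇒<ˡᵉˣ : {b c : Box n} → b ⊏ c → b <ˡᵉˣ c
⊏⇒<ˡᵉˣ (inj₁ (r≡ , c<)) = inj₂ (r≡ , c<)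
⊏⇒<ˡᵉˣ (inj₂ (_ , r<))  = inj₁ r<

<ˡᵉˣ-asym : {b c : Box n} → b <ˡᵉˣ c → ¬ c <ˡᵉˣ b
<ˡᵉˣ-asym (inj₁ b<c)        (inj₁ c<b)        = <-asym b<c c<b
<ˡᵉˣ-asym (inj₁ b<c)        (inj₂ (c≡b , _))  = <-irrefl (sym c≡b) b<c
<ˡᵉˣ-asym (inj₂ (b≡c , _))  (inj₁ c<b)        = <-irrefl (sym b≡c) c<b
<ˡᵉˣ-asym (inj₂ (_ , b<c))  (inj₂ (_ , c<b))  = <-asym b<c c<b

-- The relation between the earlier and the later members of a linear extension.
infix 4 _≼_

_≼_ : Box n → Box n → Set
b ≼ c = b ≢ c × ¬ c ⊏ b

<ˡᵉˣ⇒≼ : {b c : Box n} → b <ˡᵉˣ c → b ≼ c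
<ˡᵉˣ⇒≼ {b = b} {c} b<c =
  (λ { refl → <ˡᵉˣ-asym {b = b} {b} b<c b<c }) , λ c⊏b → <ˡᵉˣ-asym {b = b} {c} b<c (⊏⇒<ˡᵉˣ {b = c} {b} c⊏b)

lookup-AllPairs : ∀ {a r} {A : Set a} {R : A → A → Set r} {xs : List A} → AllPairs R xs →
  ∀ {i j} → i < j → R (lookup xs i) (lookup xs j)
lookup-AllPairs (px ∷ _)  {zero}  {suc j} _   = All.lookup px (∈-lookup j)
lookup-AllPairs (_ ∷ pxs) {suc i} {suc j} i<j = lookup-AllPairs pxs (ℕ.s<s⁻¹ i<j)

-- A complete list in an order compatible with `_⊏_` is a filling, the entry of a box being its
-- index; distinctness is part of `_≼_`.
module LinearExtension (xs : List (Box n)) (sorted : AllPairs _≼_ xs)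
                       (complete : ∀ b → b ∈ₗ xs) (length-xs : length xs ≡ n * (n ∸ 1) / 2) where

  lookup-injective : ∀ {i j} → lookup xs i ≡ lookup xs j → i ≡ j
  lookup-injective {i} {j} eq with <-cmp i j
  ... | tri< i<j _ _ = contradiction eq (proj₁ (lookup-AllPairs sorted i<j))
  ... | tri≈ _ i≡j _ = i≡j
  ... | tri> _ _ j<i = contradiction (sym eq) (proj₁ (lookup-AllPairs sorted j<i))

  lookup-position : ∀ b → lookup xs (index (complete b)) ≡ b
  lookup-position b = sym (lookup-index (complete b))

  position : Box n ↔ Fin (length xs)
  position = mk↔ₛ′ (index ∘ complete) (lookup xs)
    (λ i → lookup-injective (lookup-position (lookup xs i))) lookup-position

  entries : Box n ↔ Fin (n * (n ∸ 1) / 2)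
  entries = cast-id length-xs ↔-∘ position

  toℕ-entry : ∀ b → toℕ (Inverse.to entries b) ≡ toℕ (index (complete b))
  toℕ-entry b = toℕ-cast length-xs (index (complete b))

  increasing : {b c : Box n} → b ⊏ c → Inverse.to entries b < Inverse.to entries c
  increasing {b} {c} b⊏c with <-cmp (index (complete b)) (index (complete c))
  ... | tri< lt _ _ = subst₂ ℕ._<_ (sym (toℕ-entry b)) (sym (toℕ-entry c)) lt
  ... | tri≈ _ eq _ = contradiction
    (subst (_⊏ c) (trans (sym (lookup-position b)) (trans (cong (lookup xs) eq) (lookup-position c))) b⊏c)
    (⊏-irrefl {b = c})
  ... | tri> _ _ gt = contradiction
    (subst₂ _⊏_ (sym (lookup-position b)) (sym (lookup-position c)) b⊏c)
    (proj₂ (lookup-AllPairs sorted gt))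

  filling : Filling n
  filling = record
    { entries        = entries
    ; row-increasing = λ _ _ r≡ c< → increasing (inj₁ (r≡ , c<))
    ; col-increasing = λ _ _ c≡ r< → increasing (inj₂ (c≡ , r<))
    }

module _ {a p} {A : Set a} {P : Pred A p} (P? : Decidable P) where

  filter-first : List A → List A
  filter-first xs = filter P? xs ++ filter (∁? P?) xs

  length-filter-first : ∀ xs → length (filter-first xs) ≡ length xs
  length-filter-first []       = refl
  length-filter-first (x ∷ xs) with does (P? x)
  ... | true  = cong ℕ.suc (length-filter-first xs)
  ... | false = begin
    length (filter P? xs ++ x ∷ filter (∁? P?) xs)           ≡⟨ length-++ (filter P? xs) ⟩
    length (filter P? xs) + ℕ.suc (length (filter (∁? P?) xs)) ≡⟨ ℕ.+-suc _ _ ⟩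
    ℕ.suc (length (filter P? xs) + length (filter (∁? P?) xs)) ≡⟨ cong ℕ.suc (length-++ (filter P? xs)) ⟨
    ℕ.suc (length (filter-first xs))                         ≡⟨ cong ℕ.suc (length-filter-first xs) ⟩
    ℕ.suc (length xs)                                        ∎
    where open ≡-Reasoning

lookup-++-<ˡ : ∀ {a} {A : Set a} (xs ys : List A) (i : Fin (length (xs ++ ys))) →
  toℕ i ℕ.< length xs → lookup (xs ++ ys) i ∈ₗ xs
lookup-++-<ˡ (x ∷ xs) ys zero    _   = here refl
lookup-++-<ˡ (x ∷ xs) ys (suc i) i<n = there (lookup-++-<ˡ xs ys i (ℕ.s<s⁻¹ i<n))

lookup-++-≥ʳ : ∀ {a} {A : Set a} (xs ys : List A) (i : Fin (length (xs ++ ys))) →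
  length xs ℕ.≤ toℕ i → lookup (xs ++ ys) i ∈ₗ ys
lookup-++-≥ʳ []       ys i       _         = ∈-lookup i
lookup-++-≥ʳ (x ∷ xs) ys (suc i) (s≤s n≤i) = lookup-++-≥ʳ xs ys i n≤i

module IdealFilling (S : Pred (Box n) _) (S? : Decidable S) (ideal : IsIdeal S) where

  ordered : List (Box n)
  ordered = filter-first S? (boxes n)

  -- Inside each block reading order suffices; across the blocks, a box outside the ideal cannot
  -- precede one inside it.
  ordered-sorted : AllPairs _≼_ ordered
  ordered-sorted = AllPairs.++⁺ (AllPairs.filter⁺ S? ≼-boxes) (AllPairs.filter⁺ (∁? S?) ≼-boxes)
    (All.tabulate λ b∈ → All.tabulate λ c∈ →
      cross (proj₂ (∈-filter⁻ S? {xs = boxes n} b∈)) (proj₂ (∈-filter⁻ (∁? S?) {xs = boxes n} c∈)))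
    where
    ≼-boxes : AllPairs _≼_ (boxes n)
    ≼-boxes = AllPairs.map <ˡᵉˣ⇒≼ (boxes-sorted n)
    cross : {b c : Box n} → S b → ¬ S c → b ≼ c
    cross Sb ¬Sc = (λ { refl → ¬Sc Sb }) , λ c⊏b → ¬Sc (ideal _ _ c⊏b Sb)

  ∈-ordered : ∀ b → b ∈ₗ ordered
  ∈-ordered b with S? b
  ... | yes Sb = ∈-++⁺ˡ (∈-filter⁺ S? (∈-boxes b) Sb)
  ... | no ¬Sb = ∈-++⁺ʳ (filter S? (boxes n)) (∈-filter⁺ (∁? S?) (∈-boxes b) ¬Sb)

  open LinearExtension ordered ordered-sorted ∈-ordered
    (trans (length-filter-first S? (boxes n)) (length-boxes n))

  partialFilling : PartialFilling n
  -- Erasing beyond the number of boxes in `S` leaves exactly the first block.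
  partialFilling = record { filling = filling ; size = length (filter S? (boxes n)) }

  filled⇔ : ∀ b → Filled partialFilling b ⇔ S b
  filled⇔ b = mk⇔ filled⇒S S⇒filled
    where
    filled⇒S : Filled partialFilling b → S b
    filled⇒S lt = proj₂ (∈-filter⁻ S? {xs = boxes n} (subst (_∈ₗ filter S? (boxes n)) (lookup-position b)
      (lookup-++-<ˡ (filter S? (boxes n)) _ (index (∈-ordered b)) (subst (ℕ._< _) (toℕ-entry b) lt))))
    S⇒filled : S b → Filled partialFilling b
    S⇒filled Sb = ℕ.≰⇒> λ ge → proj₂
      (∈-filter⁻ (∁? S?) {xs = boxes n} (subst (_∈ₗ filter (∁? S?) (boxes n)) (lookup-position b)
        (lookup-++-≥ʳ (filter S? (boxes n)) _ (index (∈-ordered b)) (subst (_ ℕ.≤_) (toℕ-entry b) ge)))) Sb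

-- Conjugation by the longest permutation

opposite-< : {i j : Fin n} → i < j → opposite j < opposite i
opposite-< {i = i} {j} i<j = subst₂ ℕ._<_ (sym (opposite-prop j)) (sym (opposite-prop i))
  (ℕ.∸-monoʳ-< (s<s i<j) (toℕ<n j))

opposite-<⁻ : {i j : Fin n} → opposite i < opposite j → j < i
opposite-<⁻ lt = subst₂ _<_ (opposite-involutive _) (opposite-involutive _) (opposite-< lt)

opposite-≤ : {i j : Fin n} → i ≤ j → opposite j ≤ opposite i
opposite-≤ i≤j = ℕ.≮⇒≥ λ lt → ℕ.<⇒≱ (opposite-<⁻ lt) i≤j

opposite-≤-swap : {i j : Fin n} → opposite i ≤ j → opposite j ≤ i
opposite-≤-swap le = subst (_ ≤_) (opposite-involutive _) (opposite-≤ le)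

opposite-≥-swap : {i j : Fin n} → i ≤ opposite j → j ≤ opposite i
opposite-≥-swap le = subst (_≤ _) (opposite-involutive _) (opposite-≤ le)

dual : Box n → Box n
dual (box r c r<c) = box (opposite c) (opposite r) (opposite-< r<c)

-- Reversing positions and complementing letters each exchange inversions with non-inversions;
-- together they only reflect the box.
w₀-conj-inversion : (π : Permutation′ n) (b : Box n) → Inversion (w₀-conj π) b ⇔ Inversion π (dual b)
w₀-conj-inversion π b = mk⇔ opposite-<⁻ opposite-<

w₀-conj-inversion′ : (π : Permutation′ n) (b : Box n) → Inversion (w₀-conj π) (dual b) ⇔ Inversion π b
w₀-conj-inversion′ π b = ⇔.trans (w₀-conj-inversion π (dual b))
  (subst (λ c → Inversion π c ⇔ Inversion π b)
    (box-≡ {b = b} {dual (dual b)}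
      (sym (opposite-involutive (row b))) (sym (opposite-involutive (col b))))
    ⇔.refl)

w₀-conj-⊑ : (π τ : Permutation′ n) →
  π ⊑ τ → w₀-conj π ⊑ w₀-conj τ
w₀-conj-⊑ π τ inc b = from (w₀-conj-inversion τ b) ∘ inc (dual b) ∘ to (w₀-conj-inversion π b)

w₀-conj-⊑⁻ : (π τ : Permutation′ n) →
  w₀-conj π ⊑ w₀-conj τ → π ⊑ τ
w₀-conj-⊑⁻ π τ inc b = to (w₀-conj-inversion′ τ b) ∘ inc (dual b) ∘ from (w₀-conj-inversion′ π b)

w₀-conj-involutive : (π : Permutation′ n) → π ≈ w₀-conj (w₀-conj π)
w₀-conj-involutive π i =
  sym (trans (opposite-involutive _) (cong (π ⟨$⟩ʳ_) (opposite-involutive i)))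

w₀-conj-cong : (π τ : Permutation′ n) → π ≈ τ → w₀-conj π ≈ w₀-conj τ
w₀-conj-cong π τ π≈τ i = cong opposite (π≈τ (opposite i))

≈-inversion : (π τ : Permutation′ n) → π ≈ τ → ∀ b → Inversion π b ⇔ Inversion τ b
≈-inversion π τ π≈τ b
  rewrite ≈⇒⟨$⟩ˡ π τ π≈τ (row b) | ≈⇒⟨$⟩ˡ π τ π≈τ (col b) = ⇔.refl

-- Left-unimodality under conjugation

LeftUnimodal-resp-≈ : (π τ : Permutation′ n) → π ≈ τ → LeftUnimodal π → LeftUnimodal τ
LeftUnimodal-resp-≈ π τ π≈τ lu j =
  let l , u , interval = lu j
  in l , u , λ y → ⇔.trans (mk⇔
    (λ (i , i≤j , eq) → i , i≤j , trans (π≈τ i) eq)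
    (λ (i , i≤j , eq) → i , i≤j , trans (sym (π≈τ i)) eq)) (interval y)

LeftUnimodal-id : LeftUnimodal (id {n})
LeftUnimodal-id {ℕ.suc n} j = zero , j , λ y → mk⇔
  (λ { (_ , i≤j , refl) → z≤n , i≤j }) (λ (_ , y≤j) → y , y≤j , refl)

LeftUnimodal-w₀ : LeftUnimodal (w₀ {n})
LeftUnimodal-w₀ {ℕ.suc n} j = opposite j , fromℕ n , λ y → mk⇔
  (λ { (i , i≤j , refl) → opposite-≤ i≤j , ≤fromℕ (opposite i) })
  (λ (oj≤y , _) → opposite y , opposite-≤-swap oj≤y , opposite-involutive y)

-- The prefix ending at `j` comes from the suffix starting at `opposite j`; complementing its
-- letters makes the endpoints of the interval trade places.
suffixes⇒LeftUnimodal-w₀-conj : (π : Permutation′ n) → (∀ j → IsInterval (suffixSet π j)) →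
  LeftUnimodal (w₀-conj π)
suffixes⇒LeftUnimodal-w₀-conj π suffixes j =
  let l , u , interval = suffixes (opposite j)
  in opposite u , opposite l , λ y → mk⇔
    (λ { (i , i≤j , refl) →
         let l≤ , ≤u = to (interval _) (opposite i , opposite-≤ i≤j , refl)
         in opposite-≤ ≤u , opposite-≤ l≤ })
    (λ (ou≤y , y≤ol) →
         let i , oj≤i , eq = from (interval (opposite y)) (opposite-≥-swap y≤ol , opposite-≤-swap ou≤y)
         in opposite i , opposite-≤-swap oj≤i ,
            trans (cong (opposite ∘ (π ⟨$⟩ʳ_)) (opposite-involutive i))
                  (trans (cong opposite eq) (opposite-involutive y)))

Unimodal⇒ : (π : Permutation′ n) → Unimodal π → LeftUnimodal π ⊎ LeftUnimodal (w₀-conj π)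
Unimodal⇒ π (inj₁ lu)       = inj₁ lu
Unimodal⇒ π (inj₂ suffixes) = inj₂ (suffixes⇒LeftUnimodal-w₀-conj π suffixes)

w₀LeftUnimodalw₀⇔ : (π : Permutation′ n) → w₀LeftUnimodalw₀ π ⇔ LeftUnimodal (w₀-conj π)
w₀LeftUnimodalw₀⇔ π = mk⇔
  (λ (ρ , lu , π≈) → LeftUnimodal-resp-≈ ρ (w₀-conj π)
    (λ i → trans (w₀-conj-involutive ρ i) (sym (w₀-conj-cong π (w₀-conj ρ) π≈ i))) lu)
  (λ lu → w₀-conj π , lu , w₀-conj-involutive π)

-- A nonempty ideal contains the corner (1 , 2), so its dual contains the last
-- box (n-1 , n); an ideal containing the last box is the whole staircase.
inversions-full : (π τ : Permutation′ n) → LeftUnimodal π → LeftUnimodal (w₀-conj τ) →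
  π ⊑ τ → ∀ b → Inversion π b → ∀ c → Inversion (w₀-conj τ) c
inversions-full {ℕ.suc ℕ.zero} _ _ _ _ _ (box zero zero ())
inversions-full {ℕ.suc (ℕ.suc n)} π τ luπ luτ inc b πb c =
  ideal-below (Inversion (w₀-conj τ)) (LeftUnimodal⇒ideal (w₀-conj τ) luτ)
    {c} {dual corner}
    -- The column of `dual c` is `opposite (row c)`; being positive, it keeps `row c` within the row
    -- of the last box.
    (opposite-≥-swap {i = suc zero} (1≤col (dual c)))
    (opposite-≥-swap {i = zero} z≤n) last
  where
  1≤col : ∀ {m} (d : Box (ℕ.suc (ℕ.suc m))) → 1 ℕ.≤ toℕ (col d)
  1≤col (box _ (suc _) _) = s≤s z≤n
  corner : Box (ℕ.suc (ℕ.suc n))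
  corner = box zero (suc zero) z<s
  last : Inversion (w₀-conj τ) (dual corner)
  last = from (w₀-conj-inversion′ τ corner) (inc corner
    (ideal-below (Inversion π) (LeftUnimodal⇒ideal π luπ) {corner} {b} z≤n (1≤col b) πb))

-- Comparisons between the two families

anyInversion? : (π : Permutation′ n) → Dec (∃ (Inversion π))
anyInversion? π = map′
  (λ (r , c , r<c , inv) → box r c r<c , inv)
  (λ (b , inv) → row b , col b , row<col b , inv)
  (any? λ r → any? λ c → (r <? c) ×-dec (π ⟨$⟩ˡ c <? π ⟨$⟩ˡ r))

-- Without inversions the conjugate of `π` is the identity; otherwise `inversions-full` forces `τ`
-- to be `w₀`. Both are left-unimodal.
mixed-comparable : (π τ : Permutation′ n) → LeftUnimodal π → LeftUnimodal (w₀-conj τ) →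
  π ⊑ τ → LeftUnimodal (w₀-conj π) ⊎ LeftUnimodal τ
mixed-comparable π τ luπ luτ inc with anyInversion? π
... | no none = inj₁ (LeftUnimodal-resp-≈ id (w₀-conj π)
  (sameInversions⇒≈ id (w₀-conj π) λ b → mk⇔
    (λ c<r → contradiction c<r (<-asym (row<col b)))
    (λ inv → contradiction (dual b , to (w₀-conj-inversion π b) inv) none))
  LeftUnimodal-id)
... | yes (b , πb) = inj₂ (LeftUnimodal-resp-≈ w₀ τ
  (sameInversions⇒≈ w₀ τ λ c → mk⇔
    (λ _ → to (w₀-conj-inversion′ τ c) (inversions-full π τ luπ luτ inc b πb (dual c)))
    (λ _ → opposite-< (row<col c)))
  LeftUnimodal-w₀)

SameSide : Permutation′ n → Permutation′ n → Set
SameSide π τ = (LeftUnimodal π × LeftUnimodal τ) ⊎ (LeftUnimodal (w₀-conj π) × LeftUnimodal (w₀-conj τ))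

comparable⇒SameSide : (π τ : Permutation′ n) → Unimodal π → Unimodal τ →
  π ⊑ τ → SameSide π τ
comparable⇒SameSide π τ uπ uτ inc with Unimodal⇒ π uπ | Unimodal⇒ τ uτ
... | inj₁ luπ | inj₁ luτ = inj₁ (luπ , luτ)
... | inj₂ luπ | inj₂ luτ = inj₂ (luπ , luτ)
... | inj₁ luπ | inj₂ luτ =
  [ (λ lu → inj₂ (lu , luτ)) , (λ lu → inj₁ (luπ , lu)) ]′ (mixed-comparable π τ luπ luτ inc)
-- Conjugating both permutations exchanges the families and reduces this to the preceding case.
... | inj₂ luπ | inj₁ luτ =
  [ (λ lu → inj₁ (LeftUnimodal-resp-≈ (w₀-conj (w₀-conj π)) π (sym ∘ w₀-conj-involutive π) lu , luτ))
  , (λ lu → inj₂ (luπ , lu)) ]′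
  (mixed-comparable (w₀-conj π) (w₀-conj τ) luπ
    (LeftUnimodal-resp-≈ τ (w₀-conj (w₀-conj τ)) (w₀-conj-involutive τ) luτ)
    (w₀-conj-⊑ π τ inc))

-- Shapes

-- Every partial filling of `π` fills just its inversions; one exists because the filling built from
-- the ideal `Inversion π` has a permutation with these inversions, which must be `π`.
shapeᴸ⇔inversion : (π : Permutation′ n) → LeftUnimodal π → ∀ b → shapeᴸ π b ⇔ Inversion π b
shapeᴸ⇔inversion π lu b = mk⇔
  (λ (f , f≈π , filled) → to (≈-inversion (toPermutation f) π f≈π b) (to (filled⇔inversion f b) filled))
  (λ πb → partialFilling
        , sameInversions⇒≈ (toPermutation partialFilling) π
            (λ c → ⇔.trans (⇔.sym (filled⇔inversion partialFilling c)) (filled⇔ c))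
        , from (filled⇔ b) πb)
  where open IdealFilling (Inversion π) (inversion? π) (LeftUnimodal⇒ideal π lu)

isInterval? : {P : Pred (Fin n) _} → Decidable P → Dec (IsInterval P)
isInterval? P? = any? λ a → any? λ b → all? λ y →
  map′ (λ (f , g) → mk⇔ f g) (λ e → to e , from e)
    ((P? y →-dec (a ≤? y ×-dec y ≤? b)) ×-dec ((a ≤? y ×-dec y ≤? b) →-dec P? y))

-- Needed because `shape` splits on left-unimodality.
leftUnimodal? : (π : Permutation′ n) → Dec (LeftUnimodal π)
leftUnimodal? π = all? λ j → isInterval? λ y → any? λ i → i ≤? j ×-dec π ⟨$⟩ʳ i ≟ y

shape-left : (π : Permutation′ n) → LeftUnimodal π → ∀ b → shape π b ⇔ Inversion π b
shape-left π lu b = mk⇔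
  [ to (shapeᴸ⇔inversion π lu b) ∘ proj₂ , (λ (¬lu , _) → contradiction lu ¬lu) ]′
  (λ πb → inj₁ (lu , from (shapeᴸ⇔inversion π lu b) πb))

-- A permutation that is left-unimodal together with its conjugate has either no
-- inversion or all of them, so both cases of shape agree on it.
shape-right : (π : Permutation′ n) → LeftUnimodal (w₀-conj π) → ∀ b → shape π b ⇔ Inversion (w₀-conj π) b
shape-right π lu b with leftUnimodal? π
... | no ¬luπ = mk⇔
  [ (λ (luπ , _) → contradiction luπ ¬luπ) , to (shapeᴸ⇔inversion (w₀-conj π) lu b) ∘ proj₂ ]′
  (λ inv → inj₂ (¬luπ , from (shapeᴸ⇔inversion (w₀-conj π) lu b) inv))
... | yes luπ = ⇔.trans (shape-left π luπ b) (mk⇔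
  (λ πb → full b πb b)
  (λ inv → to (w₀-conj-inversion′ π b) (full (dual b) (to (w₀-conj-inversion π b) inv) (dual b))))
  where
  full : ∀ b → Inversion π b → ∀ c → Inversion (w₀-conj π) c
  full = inversions-full π π luπ lu (λ _ πc → πc)

shape-⊆⇒⊑ : (π τ : Permutation′ n) → SameSide π τ →
  shape π ⊆ shape τ → π ⊑ τ
shape-⊆⇒⊑ π τ (inj₁ (luπ , luτ)) inc b πb =
  to (shape-left τ luτ b) (inc (from (shape-left π luπ b) πb))
shape-⊆⇒⊑ π τ (inj₂ (luπ , luτ)) inc = w₀-conj-⊑⁻ π τ λ b πb →
  to (shape-right τ luτ b) (inc (from (shape-right π luπ b) πb))

⊑⇒shape-⊆ : (π τ : Permutation′ n) → SameSide π τ →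
  π ⊑ τ → shape π ⊆ shape τ
⊑⇒shape-⊆ π τ (inj₁ (luπ , luτ)) inc {b} πb =
  from (shape-left τ luτ b) (inc b (to (shape-left π luπ b) πb))
⊑⇒shape-⊆ π τ (inj₂ (luπ , luτ)) inc {b} πb =
  from (shape-right τ luτ b) (w₀-conj-⊑ π τ inc b (to (shape-right π luπ b) πb))

theorem5p1 : ∀ (n : ℕ) (π τ : Permutation′ n) → π ∈ Unimodal → τ ∈ Unimodal →
    π ≤ᵂ τ ⇔
    (((π ∈ LeftUnimodal × τ ∈ LeftUnimodal) ⊎
    (π ∈ w₀LeftUnimodalw₀ × τ ∈ w₀LeftUnimodalw₀))
    × shape π ⊆ shape τ)
theorem5p1 n π τ uπ uτ = mk⇔ ⇒ ⇐
  where
  open WeakOrder π τ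

  BothLeftOrBothRight : Set
  BothLeftOrBothRight = (π ∈ LeftUnimodal × τ ∈ LeftUnimodal) ⊎
                        (π ∈ w₀LeftUnimodalw₀ × τ ∈ w₀LeftUnimodalw₀)

  sides : BothLeftOrBothRight ⇔ SameSide π τ
  sides = ⇔.refl ⊎-⇔ (w₀LeftUnimodalw₀⇔ π ×-⇔ w₀LeftUnimodalw₀⇔ τ)

  ⇒ : π ≤ᵂ τ → BothLeftOrBothRight × shape π ⊆ shape τ
  ⇒ π≤τ = from sides side , ⊑⇒shape-⊆ π τ side (≤ᵂ⇒⊑ π≤τ)
    where
    side : SameSide π τ
    side = comparable⇒SameSide π τ uπ uτ (≤ᵂ⇒⊑ π≤τ)

  ⇐ : BothLeftOrBothRight × shape π ⊆ shape τ → π ≤ᵂ τ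
  ⇐ (side , shapes) = ⊑⇒≤ᵂ (shape-⊆⇒⊑ π τ (to sides side) shapes)
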